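{- Let $c>1$ be a constant. Given a set $P$ of $n$ points in $d$-dimensional Hamming space $\{0,1\}^d$, a positive integer $k\le n$ and block size $B$, there exists an indexing scheme using $O(n^{O(1)}d\lceil k/B\rceil)$ blocks of space such that for every query $q\in\{0,1\}^d$, some $\lceil k/B\rceil$ blocks together contain $k$ points of $P$ each at Hamming distance at most $c$ times the distance from $q$ to its $k$-th nearest neighbor in $P$.
   Context: Indexing scheme (indexability model): for a point set $P$ and block size $B$, a collection $\mathcal{B}$ of blocks, each a subset of $P$ of at most $B$ points; its space usage is $|\mathcal{B}|$; the query time for a query $q$ is the minimum number of blocks whose union contains a valid answer, the blocks being identified for free. -}

module Defs where

open import Data.Bool using (Bool; true; false)
open import Data.Nat using (ℕ; zero; suc; _+_; _∸_; _/_; NonZero)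
open import Data.Nat.Properties using (≤-decTotalOrder)
open import Data.List using (List; []; _∷_; map)
open import Data.Vec using (Vec; []; _∷_)
import Data.List.Sort

Point : ℕ → Set
Point d = Vec Bool d

bitDiff : Bool → Bool → ℕ
bitDiff true  true  = 0
bitDiff false false = 0
bitDiff true  false = 1
bitDiff false true  = 1

hamming : ∀ {d} → Point d → Point d → ℕ
hamming []       []       = 0
hamming (x ∷ xs) (y ∷ ys) = bitDiff x y + hamming xs ys

ceilDiv : ℕ → (B : ℕ) → .{{NonZero B}} → ℕ
ceilDiv k B = (k + (B ∸ 1)) / B

nth : List ℕ → ℕ → ℕ
nth []       _       = 0
nth (x ∷ xs) zero    = x
nth (x ∷ xs) (suc i) = nth xs i

open Data.List.Sort ≤-decTotalOrder using (sort)

-- Distance from q to its k-th nearest neighbour in P (k ≥ 1):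
-- the k-th smallest entry of the multiset of distances {hamming q p : p ∈ P}.
kthNNDist : ∀ {d} → List (Point d) → Point d → ℕ → ℕ
kthNNDist P q k = nth (sort (map (hamming q) P)) (k ∸ 1)

{-# OPTIONS --safe #-}

-- Hamming distance is the squared Euclidean distance on bit vectors, so answers can be read
-- off from centres in ℝᵈ: to each centre belongs the set of the k points of P nearest to it.
-- Start with a centre in P at distance at most H from q, where H is the k-th neighbour
-- distance. If the k points nearest to the centre z contain a point p that is too far from q,
-- they miss some g with |g − q|² ≤ H. Then |z − p| ≤ |z − g| although p is much further
-- from q than g, so replacing z by z + (g − p)/M decreases |z − q|² by a constant fraction
-- of H. Hence some centre reached in a constant number T of steps is good for q, and there
-- are only n·(n²)ᵀ of these.
module Submission where

open import Defs
open import Data.Bool using (Bool; true; false)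
open import Data.Integer as ℤ using (ℤ; +_)
import Data.Integer.Properties as ℤ
import Data.Integer.Tactic.RingSolver as ℤSolver
open import Data.List using (List; []; _∷_; _++_; length; map; take; drop; filter; concatMap)
open import Data.List.Membership.Propositional using (_∈_; find; lose)
open import Data.List.Membership.Propositional.Properties using (∈-++⁺ʳ; ∈-++⁻; ∈-filter⁻; ∈-concatMap⁺)
open import Data.List.Properties using (length-++; length-take; length-drop; length-map; filter-++; filter-all; filter-none; filter-notAll; take++drop≡id)
open import Data.List.Relation.Binary.Permutation.Propositional using (↭-sym; ↭⇒↭ₛ)
open import Data.List.Relation.Binary.Permutation.Propositional.Properties using (↭-length; filter-↭; ∈-resp-↭)
import Data.List.Relation.Binary.Permutation.Setoid.Properties as Permₛ
open import Data.List.Relation.Unary.All as All using (All; []; _∷_)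
import Data.List.Relation.Unary.All.Properties as All
open import Data.List.Relation.Unary.AllPairs using (AllPairs; []; _∷_)
open import Data.List.Relation.Unary.Any as Any using (Any; here; there)
open import Data.List.Relation.Unary.Sorted.TotalOrder.Properties using (Sorted⇒AllPairs)
open import Data.List.Relation.Unary.Unique.Propositional using (Unique)
import Data.List.Relation.Unary.Unique.Propositional.Properties as Unique
import Data.List.Sort
open import Data.Nat using (ℕ; zero; suc; _+_; _*_; _∸_; _^_; _%_; _≤_; _<_; _≤?_; _⊓_; z≤n; s≤s; NonZero; >-nonZero)
open import Data.Nat.DivMod using (m≡m%n+[m/n]*n; m%n<n)
open import Data.Nat.Properties
open import Data.Nat.Tactic.RingSolver using (solve-∀)
open import Data.Product using (_×_; ∃-syntax; _,_)
open import Data.Sum using (inj₁; inj₂)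
open import Data.Vec as Vec using (Vec; []; _∷_)
open import Function using (_∘_)
open import Level using (0ℓ)
import Relation.Binary.Construct.On as On
open import Relation.Binary.Core using (Rel)
open import Relation.Binary.PropositionalEquality using (_≡_; refl; sym; trans; cong; cong₂; subst; setoid; module ≡-Reasoning)
open import Relation.Nullary using (¬_; yes; no; contradiction)
open import Relation.Unary using (Pred; Decidable)

-- Lists

length-concatMap : ∀ {X Y : Set} {f : X → List Y} {m} → (∀ x → length (f x) ≡ m) →
                   ∀ xs → length (concatMap f xs) ≡ length xs * m
length-concatMap eq []       = refl
length-concatMap {f = f} eq (x ∷ xs) =
  trans (length-++ (f x)) (cong₂ _+_ (eq x) (length-concatMap eq xs))

length-filter-map : ∀ {X Y : Set} {Q : Pred Y 0ℓ} (Q? : Decidable Q) (f : X → Y) xs →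
                    length (filter Q? (map f xs)) ≡ length (filter (Q? ∘ f) xs)
length-filter-map Q? f []       = refl
length-filter-map Q? f (x ∷ xs) with Q? (f x)
... | yes _ = cong suc (length-filter-map Q? f xs)
... | no  _ = length-filter-map Q? f xs

AllPairs-take-drop : ∀ {X : Set} {R : Rel X 0ℓ} k {xs x y} → AllPairs R xs →
                     x ∈ take k xs → y ∈ drop k xs → R x y
AllPairs-take-drop (suc k) {_ ∷ xs} (rs ∷ _) (here refl) y∈ =
  All.lookup rs (subst (_ ∈_) (take++drop≡id k xs) (∈-++⁺ʳ (take k xs) y∈))
AllPairs-take-drop (suc k) {_ ∷ _} (_ ∷ rs) (there x∈) y∈ = AllPairs-take-drop k rs x∈ y∈

module _ {X : Set} {Q : Pred X 0ℓ} (Q? : Decidable Q) where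

  length-filter-take-drop : ∀ k xs → length (filter Q? xs) ≡
    length (filter Q? (take k xs)) + length (filter Q? (drop k xs))
  length-filter-take-drop k xs = begin
    length (filter Q? xs)                                         ≡⟨ cong (length ∘ filter Q?) (take++drop≡id k xs) ⟨
    length (filter Q? (take k xs ++ drop k xs))                   ≡⟨ cong length (filter-++ Q? (take k xs) (drop k xs)) ⟩
    length (filter Q? (take k xs) ++ filter Q? (drop k xs))       ≡⟨ length-++ (filter Q? (take k xs)) ⟩
    length (filter Q? (take k xs)) + length (filter Q? (drop k xs)) ∎
    where open ≡-Reasoning

  -- An element outside `Q` occupies one of the first `k` places, so fewer than `k` elements of `Q`
  -- fit there and the rest of the list must hold another.
  pigeonhole-drop : ∀ k xs → k ≤ length (filter Q? xs) → Any (¬_ ∘ Q) (take k xs) → Any Q (drop k xs)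
  pigeonhole-drop k xs k≤ bad with Any.any? Q? (drop k xs)
  ... | yes any = any
  ... | no none = contradiction k≤ (<⇒≱ (begin-strict
    length (filter Q? xs)                                           ≡⟨ length-filter-take-drop k xs ⟩
    length (filter Q? (take k xs)) + length (filter Q? (drop k xs)) ≡⟨ cong (λ l → length (filter Q? (take k xs)) + length l) (filter-none Q? (All.¬Any⇒All¬ _ none)) ⟩
    length (filter Q? (take k xs)) + 0                              ≡⟨ +-identityʳ _ ⟩
    length (filter Q? (take k xs))                                  <⟨ filter-notAll Q? (take k xs) bad ⟩
    length (take k xs)                                              ≡⟨ length-take k xs ⟩
    k ⊓ length xs                                          ≤⟨ m⊓n≤m k _ ⟩
    k                                                               ∎))
    where open ≤-Reasoning

-- The number of blocks is prescribed, the last ones possibly short or empty, so that every answer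
-- costs exactly the same space.
chunks : ∀ {X : Set} → ℕ → ℕ → List X → List (List X)
chunks zero    B xs = []
chunks (suc m) B xs = take B xs ∷ chunks m B (drop B xs)

length-chunks : ∀ {X : Set} m B (xs : List X) → length (chunks m B xs) ≡ m
length-chunks zero    B xs = refl
length-chunks (suc m) B xs = cong suc (length-chunks m B (drop B xs))

chunks-All : ∀ {X : Set} {Q : Pred X 0ℓ} m B {xs : List X} → All Q xs →
             All (λ blk → All Q blk × length blk ≤ B) (chunks m B xs)
chunks-All zero    B all = []
chunks-All (suc m) B {xs} all =
  (All.take⁺ B all , ≤-trans (≤-reflexive (length-take B xs)) (m⊓n≤m B _))
  ∷ chunks-All m B (All.drop⁺ B all)

chunks-cover : ∀ {X : Set} m B (xs : List X) → length xs ≤ m * B →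
               ∀ {x} → x ∈ xs → Any (x ∈_) (chunks m B xs)
chunks-cover zero    B (_ ∷ _) () x∈
chunks-cover (suc m) B xs len x∈
  with ∈-++⁻ (take B xs) (subst (_ ∈_) (sym (take++drop≡id B xs)) x∈)
... | inj₁ x∈take = here x∈take
... | inj₂ x∈drop = there (chunks-cover m B (drop B xs) (begin
    length (drop B xs) ≡⟨ length-drop B xs ⟩
    length xs ∸ B      ≤⟨ ∸-monoˡ-≤ B len ⟩
    B + m * B ∸ B      ≡⟨ m+n∸m≡n B (m * B) ⟩
    m * B              ∎) x∈drop)
  where open ≤-Reasoning

ceilDiv-upper : ∀ k B .{{_ : NonZero B}} → k ≤ ceilDiv k B * B
ceilDiv-upper k (suc B) = +-cancelʳ-≤ B k _ (begin
  k + B                                                ≡⟨ m≡m%n+[m/n]*n (k + B) (suc B) ⟩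
  (k + B) % suc B + ceilDiv k (suc B) * suc B          ≤⟨ +-monoˡ-≤ _ (≤-pred (m%n<n (k + B) (suc B))) ⟩
  B + ceilDiv k (suc B) * suc B                        ≡⟨ +-comm B _ ⟩
  ceilDiv k (suc B) * suc B + B                        ∎)
  where open ≤-Reasoning

-- Nearest neighbours

bitDiff-sym : ∀ x y → bitDiff x y ≡ bitDiff y x
bitDiff-sym true  true  = refl
bitDiff-sym true  false = refl
bitDiff-sym false true  = refl
bitDiff-sym false false = refl

hamming-sym : ∀ {d} (x y : Point d) → hamming x y ≡ hamming y x
hamming-sym []       []       = refl
hamming-sym (x ∷ xs) (y ∷ ys) = cong₂ _+_ (bitDiff-sym x y) (hamming-sym xs ys)

bitDiff-triangle : ∀ x y z → bitDiff x z ≤ bitDiff x y + bitDiff y z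
bitDiff-triangle true  true  z     = ≤-refl
bitDiff-triangle false false z     = ≤-refl
bitDiff-triangle true  false true  = z≤n
bitDiff-triangle true  false false = ≤-refl
bitDiff-triangle false true  true  = ≤-refl
bitDiff-triangle false true  false = z≤n

hamming-triangle : ∀ {d} (x y z : Point d) → hamming x z ≤ hamming x y + hamming y z
hamming-triangle []       []       []       = z≤n
hamming-triangle (x ∷ xs) (y ∷ ys) (z ∷ zs) = begin
  bitDiff x z + hamming xs zs                                       ≤⟨ +-mono-≤ (bitDiff-triangle x y z) (hamming-triangle xs ys zs) ⟩
  (bitDiff x y + bitDiff y z) + (hamming xs ys + hamming ys zs)     ≡⟨ +-interchange (bitDiff x y) (bitDiff y z) _ _ ⟩
  (bitDiff x y + hamming xs ys) + (bitDiff y z + hamming ys zs)     ∎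
  where
  open ≤-Reasoning
  +-interchange : ∀ a b c e → (a + b) + (c + e) ≡ (a + c) + (b + e)
  +-interchange = solve-∀

take-≤-nth : ∀ i {xs} → AllPairs _≤_ xs → i < length xs → All (_≤ nth xs i) (take (suc i) xs)
take-≤-nth zero    {_ ∷ _}  _        _         = ≤-refl ∷ []
take-≤-nth (suc i) {_ ∷ xs} (rs ∷ p) (s≤s i<n) = All.lookup rs (nth-∈ i i<n) ∷ take-≤-nth i p i<n
  where
  nth-∈ : ∀ i {xs} → i < length xs → nth xs i ∈ xs
  nth-∈ zero    {_ ∷ _} _         = here refl
  nth-∈ (suc i) {_ ∷ _} (s≤s i<n) = there (nth-∈ i i<n)

near? : ∀ {d} (q : Point d) r → Decidable (λ p → hamming q p ≤ r)
near? q r p = hamming q p ≤? r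

-- The first `k` sorted distances are at most the entry at index `k ∸ 1`, and sorting does not
-- change how many distances lie below a threshold. The bound `k ≤ length P` keeps `nth` away from
-- its default value 0.
kthNNDist-count : ∀ {d} (P : List (Point d)) q k → 1 ≤ k → k ≤ length P →
                  k ≤ length (filter (near? q (kthNNDist P q k)) P)
kthNNDist-count P q k@(suc i) _ k≤n = begin
  k                                                      ≡⟨ m≤n⇒m⊓n≡m k≤len ⟨
  k ⊓ length ds                                 ≡⟨ length-take k ds ⟨
  length (take k ds)                                     ≡⟨ cong length (filter-all (_≤? H) (take-≤-nth i ds-sorted k≤len)) ⟨
  length (filter (_≤? H) (take k ds))                    ≤⟨ m≤m+n _ _ ⟩
  length (filter (_≤? H) (take k ds)) + length (filter (_≤? H) (drop k ds))
                                                         ≡⟨ length-filter-take-drop (_≤? H) k ds ⟨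
  length (filter (_≤? H) ds)                             ≡⟨ ↭-length (filter-↭ (_≤? H) (sort-↭ (map (hamming q) P))) ⟩
  length (filter (_≤? H) (map (hamming q) P))            ≡⟨ length-filter-map (_≤? H) (hamming q) P ⟩
  length (filter (near? q H) P)                          ∎
  where
  open ≤-Reasoning
  open Data.List.Sort ≤-decTotalOrder using (sort; sort-↭; sort-↗)
  H  = kthNNDist P q k
  ds = sort (map (hamming q) P)
  ds-sorted = Sorted⇒AllPairs ≤-totalOrder (sort-↗ (map (hamming q) P))
  k≤len : k ≤ length ds
  k≤len = ≤-trans k≤n (≤-reflexive (sym (trans (↭-length (sort-↭ _)) (length-map (hamming q) P))))

module Lowest {X : Set} (key : X → ℕ) where

  open Data.List.Sort (On.decTotalOrder ≤-decTotalOrder key) using (sort; sort-↭; sort-↗)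

  lowest : ℕ → List X → List X
  lowest k xs = take k (sort xs)

  lowest-length : ∀ k xs → k ≤ length xs → length (lowest k xs) ≡ k
  lowest-length k xs k≤ = trans (length-take k (sort xs))
    (m≤n⇒m⊓n≡m (≤-trans k≤ (≤-reflexive (sym (↭-length (sort-↭ xs))))))

  lowest-⊆ : ∀ k xs → All (_∈ xs) (lowest k xs)
  lowest-⊆ k xs = All.take⁺ k (All.tabulate (∈-resp-↭ (sort-↭ xs)))

  lowest-unique : ∀ k {xs} → Unique xs → Unique (lowest k xs)
  lowest-unique k {xs} u =
    Unique.take⁺ k (Permₛ.Unique-resp-↭ (setoid X) (↭⇒↭ₛ (↭-sym (sort-↭ xs))) u)

  -- By pigeonhole some element of `Q` is left out in favour of `p`, and sorting puts nothing with a
  -- smaller key behind `p`. Only the weak inequality is claimed, so ties may be broken in any way.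
  lowest-exchange : ∀ {Q : Pred X 0ℓ} (Q? : Decidable Q) k xs → k ≤ length (filter Q? xs) →
                    ∀ {p} → p ∈ lowest k xs → ¬ Q p → ∃[ g ] (g ∈ xs × Q g × key p ≤ key g)
  lowest-exchange Q? k xs k≤ p∈ ¬Qp
    with find (pigeonhole-drop Q? k (sort xs)
                (≤-trans k≤ (≤-reflexive (sym (↭-length (filter-↭ Q? (sort-↭ xs))))))
                (lose p∈ ¬Qp))
  ... | g , g∈drop , Qg =
    g , All.lookup (All.drop⁺ k (All.tabulate (∈-resp-↭ (sort-↭ xs)))) g∈drop , Qg
      , AllPairs-take-drop k (Sorted⇒AllPairs (On.totalOrder ≤-totalOrder key) (sort-↗ xs)) p∈ g∈drop

-- Centres

bit : Bool → ℤ
bit true  = + 1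
bit false = + 0

-- Squares take values in ℕ so that energies can be compared and cancelled there; `+sq` leads back
-- to ℤ, where subtraction is exact and the ring solver applies.
sq : ℤ → ℕ
sq i = ℤ.∣ i ∣ * ℤ.∣ i ∣

+sq : ∀ i → + sq i ≡ i ℤ.* i
+sq (+ n)        = ℤ.pos-* n n
+sq ℤ.-[1+ n ]   = refl

+bitDiff : ∀ x y → + bitDiff x y ≡ (bit x ℤ.- bit y) ℤ.* (bit x ℤ.- bit y)
+bitDiff true  true  = refl
+bitDiff true  false = refl
+bitDiff false true  = refl
+bitDiff false false = refl

-- A vector w stands for the centre w / M.
Centre : ℕ → Set
Centre d = Vec ℤ d

-- The move from z to z + (g - p)/M, scaled by M so that coordinates remain integers.
step : ∀ {d} → Centre d → Point d → Point d → Centre d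
step []      []       []       = []
step (w ∷ ws) (g ∷ gs) (p ∷ ps) = w ℤ.+ (bit g ℤ.- bit p) ∷ step ws gs ps

-- Provides idle steps, which pad a shorter walk to a prescribed length.
step-id : ∀ {d} (w : Centre d) (p : Point d) → step w p p ≡ w
step-id []       []       = refl
step-id (w ∷ ws) (p ∷ ps) =
  cong₂ _∷_ (trans (cong (λ i → w ℤ.+ i) (ℤ.+-inverseʳ (bit p))) (ℤ.+-identityʳ w)) (step-id ws ps)

module Energy (M : ℕ) where

  offset : ℤ → Bool → ℤ
  offset w x = w ℤ.- + M ℤ.* bit x

  -- The squared Euclidean distance |w - Mx|², which is M² times that from the centre w / M to x.
  -- The factor is common to all x, so ranking points by energy ranks them by distance.
  energy : ∀ {d} → Centre d → Point d → ℕ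
  energy []       []       = 0
  energy (w ∷ ws) (x ∷ xs) = sq (offset w x) + energy ws xs

  centre : ∀ {d} → Point d → Centre d
  centre = Vec.map (λ x → + M ℤ.* bit x)

  energy-centre : ∀ {d} (p q : Point d) → energy (centre p) q ≡ M * M * hamming p q
  energy-centre []       []       = sym (*-zeroʳ (M * M))
  energy-centre (p ∷ ps) (q ∷ qs) =
    trans (cong₂ _+_ coordinate (energy-centre ps qs)) (sym (*-distribˡ-+ (M * M) (bitDiff p q) _))
    where
    identity : ∀ m x y → (m ℤ.* x ℤ.- m ℤ.* y) ℤ.* (m ℤ.* x ℤ.- m ℤ.* y) ≡ m ℤ.* m ℤ.* ((x ℤ.- y) ℤ.* (x ℤ.- y))
    identity = ℤSolver.solve-∀
    coordinate : sq (offset (+ M ℤ.* bit p) q) ≡ M * M * bitDiff p q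
    coordinate = ℤ.+-injective (begin
      + sq (offset (+ M ℤ.* bit p) q)                                  ≡⟨ +sq (offset (+ M ℤ.* bit p) q) ⟩
      offset (+ M ℤ.* bit p) q ℤ.* offset (+ M ℤ.* bit p) q            ≡⟨ identity (+ M) (bit p) (bit q) ⟩
      + M ℤ.* + M ℤ.* ((bit p ℤ.- bit q) ℤ.* (bit p ℤ.- bit q))        ≡⟨ cong₂ ℤ._*_ (ℤ.pos-* M M) (+bitDiff p q) ⟨
      + (M * M) ℤ.* + bitDiff p q                                      ≡⟨ ℤ.pos-* (M * M) (bitDiff p q) ⟨
      + (M * M * bitDiff p q)                                          ∎)
      where open ≡-Reasoning

  -- |w + g − p − Mq|² expanded and combined with |w − Mg|² − |w − Mp|² to eliminate the inner
  -- product of g − p and w − Mq; both sides are arranged to be free of subtraction.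
  energy-step : ∀ {d} (w : Centre d) (g p q : Point d) →
    M * energy (step w g p) q + energy w g + M * M * hamming p q
    ≡ M * energy w q + energy w p + M * M * hamming g q + M * hamming g p
  energy-step []       []       []       []       = zeros M
    where
    zeros : ∀ m → m * 0 + 0 + m * m * 0 ≡ m * 0 + 0 + m * m * 0 + m * 0
    zeros = solve-∀
  energy-step (w ∷ ws) (g ∷ gs) (p ∷ ps) (q ∷ qs) = begin
    _ ≡⟨ splitˡ M (sq (offset (w ℤ.+ (bit g ℤ.- bit p)) q)) (sq (offset w g)) (bitDiff p q) _ _ _ ⟩
    _ ≡⟨ cong₂ _+_ coordinate (energy-step ws gs ps qs) ⟩
    _ ≡⟨ splitʳ M (sq (offset w q)) (sq (offset w p)) (bitDiff g q) (bitDiff g p) _ _ _ _ ⟨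
    _ ∎
    where
    open ≡-Reasoning
    splitˡ : ∀ m e f h e′ f′ h′ → m * (e + e′) + (f + f′) + m * m * (h + h′)
             ≡ (m * e + f + m * m * h) + (m * e′ + f′ + m * m * h′)
    splitˡ = solve-∀
    splitʳ : ∀ m e f h i e′ f′ h′ i′ → m * (e + e′) + (f + f′) + m * m * (h + h′) + m * (i + i′)
             ≡ (m * e + f + m * m * h + m * i) + (m * e′ + f′ + m * m * h′ + m * i′)
    splitʳ = solve-∀
    _² : ℤ → ℤ
    i ² = i ℤ.* i
    identity : ∀ m w g p q →
      m ℤ.* ((w ℤ.+ (g ℤ.- p) ℤ.- m ℤ.* q) ℤ.* (w ℤ.+ (g ℤ.- p) ℤ.- m ℤ.* q))
        ℤ.+ (w ℤ.- m ℤ.* g) ℤ.* (w ℤ.- m ℤ.* g)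
        ℤ.+ m ℤ.* m ℤ.* ((p ℤ.- q) ℤ.* (p ℤ.- q))
      ≡ m ℤ.* ((w ℤ.- m ℤ.* q) ℤ.* (w ℤ.- m ℤ.* q))
        ℤ.+ (w ℤ.- m ℤ.* p) ℤ.* (w ℤ.- m ℤ.* p)
        ℤ.+ m ℤ.* m ℤ.* ((g ℤ.- q) ℤ.* (g ℤ.- q))
        ℤ.+ m ℤ.* ((g ℤ.- p) ℤ.* (g ℤ.- p))
    identity = ℤSolver.solve-∀
    M*sq : ∀ i → + (M * sq i) ≡ + M ℤ.* (i ²)
    M*sq i = trans (ℤ.pos-* M (sq i)) (cong (+ M ℤ.*_) (+sq i))
    M*bitDiff : ∀ x y → + (M * bitDiff x y) ≡ + M ℤ.* ((bit x ℤ.- bit y) ²)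
    M*bitDiff x y = trans (ℤ.pos-* M (bitDiff x y)) (cong (+ M ℤ.*_) (+bitDiff x y))
    MM*bitDiff : ∀ x y → + (M * M * bitDiff x y) ≡ + M ℤ.* + M ℤ.* ((bit x ℤ.- bit y) ²)
    MM*bitDiff x y = trans (ℤ.pos-* (M * M) (bitDiff x y)) (cong₂ ℤ._*_ (ℤ.pos-* M M) (+bitDiff x y))
    w′ = offset (w ℤ.+ (bit g ℤ.- bit p)) q
    coordinate : M * sq w′ + sq (offset w g) + M * M * bitDiff p q
      ≡ M * sq (offset w q) + sq (offset w p) + M * M * bitDiff g q + M * bitDiff g p
    coordinate = ℤ.+-injective (begin
      + (M * sq w′) ℤ.+ + sq (offset w g) ℤ.+ + (M * M * bitDiff p q)
        ≡⟨ cong₂ ℤ._+_ (cong₂ ℤ._+_ (M*sq w′) (+sq (offset w g))) (MM*bitDiff p q) ⟩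
      + M ℤ.* (w′ ²) ℤ.+ (offset w g ²) ℤ.+ + M ℤ.* + M ℤ.* ((bit p ℤ.- bit q) ²)
        ≡⟨ identity (+ M) w (bit g) (bit p) (bit q) ⟩
      + M ℤ.* (offset w q ²) ℤ.+ (offset w p ²) ℤ.+ + M ℤ.* + M ℤ.* ((bit g ℤ.- bit q) ²)
        ℤ.+ + M ℤ.* ((bit g ℤ.- bit p) ²)
        ≡⟨ cong₂ ℤ._+_ (cong₂ ℤ._+_ (cong₂ ℤ._+_ (M*sq (offset w q)) (+sq (offset w p))) (MM*bitDiff g q)) (M*bitDiff g p) ⟨
      + (M * sq (offset w q)) ℤ.+ + sq (offset w p) ℤ.+ + (M * M * bitDiff g q) ℤ.+ + (M * bitDiff g p) ∎)

  module _ .{{_ : NonZero M}} where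

    -- In `energy-step` the terms `energy w g` and `energy w p` stand on opposite sides; the
    -- hypothesis cancels them, and a factor `M` divides out of the rest.
    energy-step-≤ : ∀ {d} (w : Centre d) (g p q : Point d) → energy w p ≤ energy w g →
      energy (step w g p) q + M * hamming p q ≤ energy w q + M * hamming g q + hamming g p
    energy-step-≤ w g p q p≤g = *-cancelˡ-≤ M (+-cancelʳ-≤ (energy w g) _ _ (begin
      M * (energy (step w g p) q + M * hamming p q) + energy w g
        ≡⟨ regroupˡ M (energy (step w g p) q) (hamming p q) (energy w g) ⟩
      M * energy (step w g p) q + energy w g + M * M * hamming p q
        ≡⟨ energy-step w g p q ⟩
      M * energy w q + energy w p + M * M * hamming g q + M * hamming g p
        ≡⟨ regroupʳ M (energy w q) (energy w p) (hamming g q) (hamming g p) ⟩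
      M * (energy w q + M * hamming g q + hamming g p) + energy w p
        ≤⟨ +-monoʳ-≤ _ p≤g ⟩
      M * (energy w q + M * hamming g q + hamming g p) + energy w g ∎))
      where
      open ≤-Reasoning
      regroupˡ : ∀ m e h f → m * (e + m * h) + f ≡ m * e + f + m * m * h
      regroupˡ = solve-∀
      regroupʳ : ∀ m e f h i → m * e + f + m * m * h + m * i ≡ m * (e + m * h + i) + f
      regroupʳ = solve-∀

-- The scheme

module Scheme (a b : ℕ) (b<a : b < a) where

  -- The smallest M for which the energy drop below has a positive coefficient of H.
  M T : ℕ
  M = suc (suc (2 * b))
  T = b * (M * M)

  open Energy M

  -- With `m = M - 1`, the step inequality and the triangle inequality give
  -- `E′ + m * hp ≤ E + (m + 2) * H`. Multiplying by `b` and using `b * hp > a * H ≥ (b + 1) * H`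
  -- leaves a drop of more than `(m - 2 * b) * H`, which is `H`.
  energy-drop : ∀ {d} (w : Centre d) (g p q : Point d) {H} → energy w p ≤ energy w g →
    hamming g q ≤ H → a * H < b * hamming p q → b * energy (step w g p) q + H < b * energy w q
  energy-drop w g p q {H} p≤g gH pH = +-cancelʳ-< (m * b * H + 2 * b * H) _ _ (begin-strict
    b * E′ + H + (m * b * H + 2 * b * H)          ≡⟨ regroup₁ b E′ H ⟩
    -- Here c > 1 enters: `b < a` means `suc b ≤ a`, so c = a/b exceeds 1 by at least 1/b.
    b * E′ + m * (suc b * H)                      ≤⟨ +-monoʳ-≤ (b * E′) (*-monoʳ-≤ m (*-monoˡ-≤ H b<a)) ⟩
    b * E′ + m * (a * H)                          <⟨ +-monoʳ-< (b * E′) (*-monoʳ-< m pH) ⟩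
    b * E′ + m * (b * hp)                         ≡⟨ regroup₂ b E′ m hp ⟩
    b * (E′ + m * hp)                             ≤⟨ *-monoʳ-≤ b (+-cancelʳ-≤ hp _ _ drop-with-hp) ⟩
    b * (E + M * H + H)                           ≡⟨ regroup₃ b E H ⟩
    b * E + (m * b * H + 2 * b * H)               ∎)
    where
    open ≤-Reasoning
    m  = suc (2 * b)
    E  = energy w q
    E′ = energy (step w g p) q
    hp = hamming p q
    regroup₁ : ∀ b E H → b * E + H + (suc (2 * b) * b * H + 2 * b * H) ≡ b * E + suc (2 * b) * (suc b * H)
    regroup₁ = solve-∀
    regroup₂ : ∀ b E m h → b * E + m * (b * h) ≡ b * (E + m * h)
    regroup₂ = solve-∀
    regroup₃ : ∀ b E H → b * (E + suc (suc (2 * b)) * H + H) ≡ b * E + (suc (2 * b) * b * H + 2 * b * H)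
    regroup₃ = solve-∀
    regroup₄ : ∀ E m h → E + m * h + h ≡ E + suc m * h
    regroup₄ = solve-∀
    -- Passing from `g` to `p` through `q` costs one extra `hp` on the right; it cancels one of the
    -- `M` copies on the left, leaving `m`.
    drop-with-hp : E′ + m * hp + hp ≤ E + M * H + H + hp
    drop-with-hp = begin
      E′ + m * hp + hp                        ≡⟨ regroup₄ E′ m hp ⟩
      E′ + M * hp                             ≤⟨ energy-step-≤ w g p q p≤g ⟩
      E + M * hamming g q + hamming g p       ≤⟨ +-mono-≤ (+-monoʳ-≤ E (*-monoʳ-≤ M gH)) (hamming-triangle g q p) ⟩
      E + M * H + (hamming g q + hamming q p) ≤⟨ +-monoʳ-≤ (E + M * H) (+-mono-≤ gH (≤-reflexive (hamming-sym q p))) ⟩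
      E + M * H + (H + hp)                    ≡⟨ +-assoc (E + M * H) H hp ⟨
      E + M * H + H + hp                      ∎

  module _ {d : ℕ} (P : List (Point d)) where

    -- Tries every ordered pair of points at each step without reference to a query; the walk made
    -- for a particular query is one branch of this tree.
    reachable : ℕ → Centre d → List (Centre d)
    reachable zero    w = w ∷ []
    reachable (suc s) w = concatMap (λ g → concatMap (λ p → reachable s (step w g p)) P) P

    length-reachable : ∀ s w → length (reachable s w) ≡ (length P ^ 2) ^ s
    length-reachable zero    w = refl
    length-reachable (suc s) w = trans
      (length-concatMap (λ g → length-concatMap (λ p → length-reachable s (step w g p)) P) P)
      (square (length P) _)
      where
      square : ∀ n x → n * (n * x) ≡ n * (n * 1) * x
      square = solve-∀

    step-reachable : ∀ s {w g p w′} → g ∈ P → p ∈ P → w′ ∈ reachable s (step w g p) →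
                     w′ ∈ reachable (suc s) w
    step-reachable s {w} g∈ p∈ w′∈ = ∈-concatMap⁺ _ (lose g∈ (∈-concatMap⁺ _ (lose p∈ w′∈)))

    self-reachable : ∀ s w {p} → p ∈ P → w ∈ reachable s w
    self-reachable zero    w p∈ = here refl
    self-reachable (suc s) w {p} p∈ = step-reachable s p∈ p∈
      (subst (λ v → w ∈ reachable s v) (sym (step-id w p)) (self-reachable s w p∈))

    centres : List (Centre d)
    centres = concatMap (reachable T ∘ centre) P

    length-centres : length centres ≡ length P ^ (1 + 2 * T)
    length-centres = trans (length-concatMap (length-reachable T ∘ centre) P)
                           (cong (length P *_) (^-*-assoc (length P) 2 T))

    answer : ℕ → Centre d → List (Point d)
    answer k w = Lowest.lowest (energy w) k P

    module _ (k : ℕ) (1≤k : 1 ≤ k) (k≤n : k ≤ length P) (q : Point d) where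

      private H = kthNNDist P q k

      Close : Point d → Set
      Close p = b * hamming p q ≤ a * H

      -- Induction on the number `s` of steps left, with `s * H` as a budget for `b` times the
      -- energy. A bad answer supplies a pair `g`, `p` whose step lowers this quantity by more than
      -- `H`, so the budget for `s - 1` steps suffices afterwards.
      exists-close-answer : ∀ s w {p₀} → p₀ ∈ P → b * energy w q ≤ s * H →
                            ∃[ w′ ] (w′ ∈ reachable s w × All Close (answer k w′))
      exists-close-answer s w p₀∈ E≤ with All.all? (λ p → b * hamming p q ≤? a * H) (answer k w)
      ... | yes close = w , self-reachable s w p₀∈ , close
      ... | no ¬close with find (All.¬All⇒Any¬ (λ p → b * hamming p q ≤? a * H) _ ¬close)
      ...   | p , p∈answer , p-far
        with Lowest.lowest-exchange (energy w) (near? q H) k P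
               (kthNNDist-count P q k 1≤k k≤n) p∈answer
               -- A point within `H` of `q` is close because `b ≤ a`; hence the far point `p` is not
               -- near.
               (λ p-near → p-far (*-mono-≤ (<⇒≤ b<a) (≤-trans (≤-reflexive (hamming-sym p q)) p-near)))
      ...     | g , g∈P , g-near , p≤g = continue s E≤
        where
        p∈P = All.lookup (Lowest.lowest-⊆ (energy w) k P) p∈answer
        E-drop : b * energy (step w g p) q + H < b * energy w q
        E-drop = energy-drop w g p q p≤g (≤-trans (≤-reflexive (hamming-sym g q)) g-near) (≰⇒> p-far)
        continue : ∀ s → b * energy w q ≤ s * H → ∃[ w′ ] (w′ ∈ reachable s w × All Close (answer k w′))
        -- With no budget left the energy term is zero and cannot drop strictly, so the answer was
        -- not bad.
        continue zero    E≤0 = contradiction (<-≤-trans E-drop E≤0) n≮0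
        continue (suc s) E≤
          with exists-close-answer s (step w g p) g∈P
                 (+-cancelʳ-≤ H _ _ (≤-trans (<⇒≤ E-drop) (≤-trans E≤ (≤-reflexive (+-comm H (s * H))))))
        ... | w′ , w′∈ , close = w′ , step-reachable s g∈P p∈P w′∈ , close

      near-point : ∃[ p ] (p ∈ P × hamming q p ≤ H)
      near-point with filter (near? q H) P in eq | ≤-trans 1≤k (kthNNDist-count P q k 1≤k k≤n)
      ... | p ∷ _ | _ = p , ∈-filter⁻ (near? q H) {xs = P} (subst (p ∈_) (sym eq) (here refl))

      -- The walk starts at a point of `P` within `H` of `q`, where the energy is at most
      -- `M * M * H`. Multiplied by `b` this is `T * H`, which is how `T` is chosen.
      close-centre : ∃[ w ] (w ∈ centres × All Close (answer k w))
      close-centre with near-point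
      ... | p₀ , p₀∈ , p₀-near with exists-close-answer T (centre p₀) p₀∈ (begin
        b * energy (centre p₀) q       ≡⟨ cong (b *_) (energy-centre p₀ q) ⟩
        b * (M * M * hamming p₀ q)     ≡⟨ *-assoc b (M * M) _ ⟨
        T * hamming p₀ q               ≤⟨ *-monoʳ-≤ T (≤-trans (≤-reflexive (hamming-sym p₀ q)) p₀-near) ⟩
        T * H                          ∎)
        where open ≤-Reasoning
      ...   | w , w∈ , close = w , ∈-concatMap⁺ _ (lose p₀∈ w∈) , close

theorem4 : (a b : ℕ) → 1 ≤ b → b < a →
    ∃[ C ] ∃[ e ]
    ((d : ℕ) → 1 ≤ d →
    (P : List (Point d)) → Unique P →
    (k : ℕ) → 1 ≤ k → k ≤ length P →
    (B : ℕ) → .{{_ : NonZero B}} →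
    ∃[ scheme ]
    ( All (λ blk → All (λ p → p ∈ P) blk × length blk ≤ B) scheme
    × length scheme ≤ C * (length P ^ e) * d * ceilDiv k B
    × ((q : Point d) →
    ∃[ S ] ∃[ A ]
    ( All (λ blk → blk ∈ scheme) S
    × length S ≤ ceilDiv k B
    × Unique A
    × length A ≡ k
    × All (λ p → Any (λ blk → p ∈ blk) S
    × b * hamming p q ≤ a * kthNNDist P q k) A))))
-- The exponent counts one starting point and `T` ordered pairs; it depends on `a` and `b` alone,
-- that is, on c = a/b.
theorem4 a b _ b<a = 1 , 1 + 2 * T , λ d 1≤d P uniq k 1≤k k≤n B →
  let
    m = ceilDiv k B
    blocks : Centre d → List (List (Point d))
    blocks w = chunks m B (answer P k w)
    length-answer : ∀ w → length (answer P k w) ≡ k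
    length-answer w = Lowest.lowest-length (energy w) k P k≤n
  in
  concatMap blocks (centres P) ,
  All.concat⁺ (All.map⁺ (All.universal (λ w → chunks-All m B (Lowest.lowest-⊆ (energy w) k P)) (centres P))) ,
  (begin
    length (concatMap blocks (centres P))        ≡⟨ length-concatMap (λ w → length-chunks m B (answer P k w)) (centres P) ⟩
    length (centres P) * m                       ≡⟨ cong (_* m) (length-centres P) ⟩
    length P ^ (1 + 2 * T) * m                   ≤⟨ *-monoˡ-≤ m (m≤m*n (length P ^ (1 + 2 * T)) d {{>-nonZero 1≤d}}) ⟩
    length P ^ (1 + 2 * T) * d * m               ≡⟨ cong (λ x → x * d * m) (*-identityˡ (length P ^ (1 + 2 * T))) ⟨
    1 * length P ^ (1 + 2 * T) * d * m           ∎) ,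
  λ q →
  let
    w , w∈ , close = close-centre P k 1≤k k≤n q
    len≤ : length (answer P k w) ≤ m * B
    len≤ = ≤-trans (≤-reflexive (length-answer w)) (ceilDiv-upper k B)
  in
  -- The query reads all blocks stored for the one centre `w` that is good for it, and takes the
  -- whole answer of `w`.
  blocks w , answer P k w ,
  All.tabulate (λ blk∈ → ∈-concatMap⁺ blocks (lose w∈ blk∈)) ,
  ≤-reflexive (length-chunks m B (answer P k w)) ,
  Lowest.lowest-unique (energy w) k uniq ,
  length-answer w ,
  All.tabulate (λ p∈ → chunks-cover m B (answer P k w) len≤ p∈ , All.lookup close p∈)
  where
  open Scheme a b b<a
  open Energy M using (energy)
  open ≤-Reasoning
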